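{- For every positive integer $k$, $J^{\mathrm{Lam}}_k\supseteq \mathbb Q(q)\otimes_{\mathbb Z}I^{\mathrm{Assaf}}_k$; that is, the image of every element of $I^{\mathrm{Assaf}}_k$ in $\mathcal U_q=\mathbb Q(q)\otimes_{\mathbb Z}\mathcal U$ lies in $J^{\mathrm{Lam}}_k$.
   Context: $\mathcal U=\mathbb Z\langle u_1,\dots,u_N\rangle$ is the free associative ring on noncommuting generators, $\mathbf u_{\mathsf w}=u_{\mathsf w_1}\cdots u_{\mathsf w_n}$, and $\mathcal U_q=\mathbb Q(q)\otimes_{\mathbb Z}\mathcal U$ with $\mathbb Q(q)$ the field of rational functions in $q$. Lam's ideal $J^{\mathrm{Lam}}_k$ is the two-sided ideal of $\mathcal U_q$ generated by $u_a^2$ (all $a$), $u_{a+k}u_au_{a+k}$ and $u_au_{a+k}u_a$ (all $a$), $u_au_b-u_bu_a$ for $b-a>k$, and $u_au_b-q^{ -1}u_bu_a$ for $0<b-a<k$ (indices in $\{1,\dots,N\}$). The Assaf ideal $I^{\mathrm{Assaf}}_k$ is the two-sided ideal of $\mathcal U$ generated by all monomials $\mathbf u_{\mathsf w}$ that lie in $J^{\mathrm{Lam}}_k$, together with, for $a<b<c$: $u_bu_au_c-u_bu_cu_a$ and $u_au_cu_b-u_cu_au_b$ when $c-a>k$; $u_bu_au_c-u_au_cu_b$ and $u_bu_cu_a-u_cu_au_b$ when $c-a\le k$. -}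

module Defs where

open import Data.Nat using (ℕ; zero; suc; _+_; _<_; _≤_)
open import Data.Fin using (Fin; toℕ)
open import Data.Fin.Properties using () renaming (_≟_ to _≟ᶠ_)
open import Data.Integer as ℤ using (ℤ)
open import Data.Rational as ℚ using (ℚ; 0ℚ; 1ℚ)
open import Data.List using (List; []; _∷_; _++_; map; foldr; concatMap)
open import Data.List.Properties using (≡-dec)
open import Data.List.Relation.Unary.All using (All)
open import Data.Product using (Σ; _×_; _,_; proj₁)
open import Relation.Binary.PropositionalEquality using (_≡_; cong)
open import Relation.Nullary using (¬_; yes; no)

-- Polynomials in q over ℚ: coefficient lists, lowest degree first.
Poly : Set
Poly = List ℚ

coeffP : Poly → ℕ → ℚ
coeffP []      _       = 0ℚ
coeffP (a ∷ p) zero    = a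
coeffP (a ∷ p) (suc n) = coeffP p n

-- equality of polynomials (ignores trailing zeros)
_≈ₚ_ : Poly → Poly → Set
p ≈ₚ r = ∀ n → coeffP p n ≡ coeffP r n

_+ₚ_ : Poly → Poly → Poly
[]      +ₚ r       = r
(a ∷ p) +ₚ []      = a ∷ p
(a ∷ p) +ₚ (b ∷ r) = (a ℚ.+ b) ∷ (p +ₚ r)

_*ₚ_ : Poly → Poly → Poly
[]      *ₚ r = []
(a ∷ p) *ₚ r = map (a ℚ.*_) r +ₚ (0ℚ ∷ (p *ₚ r))

NonZeroPoly : Set
NonZeroPoly = Σ Poly (λ p → ¬ (p ≈ₚ []))

-- the denominator is stored as a list of nonzero polynomial factors;
-- the actual denominator is their product.
prodDen : List NonZeroPoly → Poly
prodDen = foldr (λ x acc → proj₁ x *ₚ acc) (1ℚ ∷ [])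

record Qq : Set where
  constructor _÷_
  field
    num : Poly
    den : List NonZeroPoly
open Qq public

_≈q_ : Qq → Qq → Set
x ≈q y = (num x *ₚ prodDen (den y)) ≈ₚ (num y *ₚ prodDen (den x))

0q : Qq
0q = [] ÷ []

1q : Qq
1q = (1ℚ ∷ []) ÷ []

_+q_ : Qq → Qq → Qq
x +q y = ((num x *ₚ prodDen (den y)) +ₚ (num y *ₚ prodDen (den x))) ÷ (den x ++ den y)

_*q_ : Qq → Qq → Qq
x *q y = (num x *ₚ num y) ÷ (den x ++ den y)

-q_ : Qq → Qq
-q x = map ℚ.-_ (num x) ÷ den x

fromℤq : ℤ → Qq
fromℤq z = ((z ℚ./ 1) ∷ []) ÷ []

qPoly : NonZeroPoly
qPoly = (0ℚ ∷ 1ℚ ∷ []) , λ h → 1≢0 (h 1)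
  where
  1≢0 : ¬ (1ℚ ≡ 0ℚ)
  1≢0 ()

q⁻¹ : Qq
q⁻¹ = (1ℚ ∷ []) ÷ (qPoly ∷ [])

module FreeAlg (R : Set) (0r : R) (_+r_ _*r_ : R → R → R) (_≈r_ : R → R → Set)
               (N : ℕ) where

  -- words in the generators u_a (a : Fin N); a word w denotes u_w
  Word : Set
  Word = List (Fin N)

  -- elements: finite formal R-linear combinations of words
  Elt : Set
  Elt = List (R × Word)

  coeff : Elt → Word → R
  coeff []             w = 0r
  coeff ((c , v) ∷ f) w with ≡-dec _≟ᶠ_ v w
  ... | yes _ = c +r coeff f w
  ... | no  _ = coeff f w

  _≋_ : Elt → Elt → Set
  f ≋ g = ∀ w → coeff f w ≈r coeff g w

  sandwich : R → Word → Elt → Word → Elt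
  sandwich c x g y = map (λ { (d , v) → (c *r d , x ++ v ++ y) }) g

  record Term (G : Elt → Set) : Set where
    constructor term
    field
      scalar : R
      left   : Word
      gen    : Elt
      right  : Word
      isGen  : G gen

  evalTerms : {G : Elt → Set} → List (Term G) → Elt
  evalTerms = concatMap (λ t → sandwich (Term.scalar t) (Term.left t) (Term.gen t) (Term.right t))

  InIdeal : (Elt → Set) → Elt → Set
  InIdeal G f = Σ (List (Term G)) (λ ts → f ≋ evalTerms ts)

-- 𝒰 = ℤ⟨u_1..u_N⟩ and 𝒰_q = ℚ(q) ⊗ 𝒰 = ℚ(q)⟨u_1..u_N⟩

module 𝒰 (N : ℕ) = FreeAlg ℤ (ℤ.+ 0) ℤ._+_ ℤ._*_ _≡_ N
module 𝒰q (N : ℕ) = FreeAlg Qq 0q _+q_ _*q_ _≈q_ N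

Word : ℕ → Set
Word N = List (Fin N)

monoZ : ∀ {N} → Word N → 𝒰.Elt N
monoZ w = (ℤ.+ 1 , w) ∷ []

diffZ : ∀ {N} → Word N → Word N → 𝒰.Elt N
diffZ v w = (ℤ.+ 1 , v) ∷ (ℤ.- (ℤ.+ 1) , w) ∷ []

monoQ : ∀ {N} → Word N → 𝒰q.Elt N
monoQ w = (1q , w) ∷ []

image : ∀ {N} → 𝒰.Elt N → 𝒰q.Elt N
image = map (λ { (c , w) → (fromℤq c , w) })

data LamGen (k : ℕ) {N : ℕ} : 𝒰q.Elt N → Set where
  sq     : (a : Fin N) → LamGen k (monoQ (a ∷ a ∷ []))
  braid₁ : (a b : Fin N) → toℕ b ≡ toℕ a + k → LamGen k (monoQ (b ∷ a ∷ b ∷ []))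
  braid₂ : (a b : Fin N) → toℕ b ≡ toℕ a + k → LamGen k (monoQ (a ∷ b ∷ a ∷ []))
  comm   : (a b : Fin N) → toℕ a + k < toℕ b →
           LamGen k ((1q , a ∷ b ∷ []) ∷ (-q 1q , b ∷ a ∷ []) ∷ [])
  qcomm  : (a b : Fin N) → toℕ a < toℕ b → toℕ b < toℕ a + k →
           LamGen k ((1q , a ∷ b ∷ []) ∷ (-q q⁻¹ , b ∷ a ∷ []) ∷ [])

InJLam : (k : ℕ) {N : ℕ} → 𝒰q.Elt N → Set
InJLam k {N} = 𝒰q.InIdeal N (LamGen k)

data AssafGen (k : ℕ) {N : ℕ} : 𝒰.Elt N → Set where
  mono  : (w : Word N) → InJLam k (monoQ w) → AssafGen k (monoZ w)
  far₁  : (a b c : Fin N) → toℕ a < toℕ b → toℕ b < toℕ c → toℕ a + k < toℕ c →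
          AssafGen k (diffZ (b ∷ a ∷ c ∷ []) (b ∷ c ∷ a ∷ []))
  far₂  : (a b c : Fin N) → toℕ a < toℕ b → toℕ b < toℕ c → toℕ a + k < toℕ c →
          AssafGen k (diffZ (a ∷ c ∷ b ∷ []) (c ∷ a ∷ b ∷ []))
  near₁ : (a b c : Fin N) → toℕ a < toℕ b → toℕ b < toℕ c → toℕ c ≤ toℕ a + k →
          AssafGen k (diffZ (b ∷ a ∷ c ∷ []) (a ∷ c ∷ b ∷ []))
  near₂ : (a b c : Fin N) → toℕ a < toℕ b → toℕ b < toℕ c → toℕ c ≤ toℕ a + k →
          AssafGen k (diffZ (b ∷ c ∷ a ∷ []) (c ∷ a ∷ b ∷ []))

InIAssaf : (k : ℕ) {N : ℕ} → 𝒰.Elt N → Set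
InIAssaf k {N} = 𝒰.InIdeal N (AssafGen k)

-- The image of each Assaf generator in 𝒰_q is an explicit combination of Lam generators:
--   u_b u_a u_c − u_b u_c u_a = u_b (u_a u_c − u_c u_a),
--   u_a u_c u_b − u_c u_a u_b = (u_a u_c − u_c u_a) u_b,
--   u_b u_a u_c − u_a u_c u_b = −q (u_a u_b − q⁻¹ u_b u_a) u_c + q u_a (u_b u_c − q⁻¹ u_c u_b),
--   u_b u_c u_a − u_c u_a u_b = (u_b u_c − q⁻¹ u_c u_b) u_a − u_c (u_a u_b − q⁻¹ u_b u_a),
-- while the monomial generators lie in J^Lam_k by definition. Sandwiching these expressions
-- termwise turns a presentation of f ∈ I^Assaf_k into one of its image in J^Lam_k.
--
-- Elements of ℚ(q) are unreduced fractions compared by cross-multiplication, and transitivity of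
-- that relation would require ℚ[q] to be an integral domain. Instead, both sides of each coefficient
-- identity are shown to equal a common P / qⁿ with P ∈ ℚ[q]: every scalar above has this form,
-- and multiplication by q is cancellable in ℚ[q] because it only shifts coefficients.

module Submission where

open import Defs
open import Data.Nat using (ℕ; zero; suc; _+_; _≤_)
import Data.Nat.Properties as ℕP
open import Data.Integer as ℤ using (ℤ)
import Data.Integer.Properties as ℤP
open import Data.Rational as ℚ using (ℚ; 0ℚ; 1ℚ)
import Data.Rational.Properties as ℚP
open import Data.Rational.Literals using (fromℤ)
open import Data.Fin.Properties using () renaming (_≟_ to _≟ᶠ_)
open import Data.List using (List; []; _∷_; map; _++_; concatMap)
open import Data.List.Properties using (≡-dec; ++-assoc; ++-cancelˡ; ++-cancelʳ)
open import Data.List.Relation.Binary.Pointwise as Pointwise using (Pointwise; []; _∷_)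
open import Data.Product using (∃; _×_; _,_; proj₁)
open import Data.Sum using (_⊎_; inj₁; inj₂)
open import Data.Empty using (⊥-elim)
open import Function using (_∘_)
open import Relation.Nullary using (yes; no)
open import Relation.Binary.PropositionalEquality
open import Relation.Binary.Bundles using (Setoid)
open import Algebra.Bundles using (CommutativeRing; CommutativeSemiring; CommutativeMonoid)
open import Algebra.Structures.Biased using (isCommutativeSemiringˡ)
import Algebra.Solver.Ring.NaturalCoefficients.Default as SemiringSolver
import Algebra.Solver.CommutativeMonoid as CommutativeMonoidSolver
import Relation.Binary.Reasoning.Setoid as SetoidReasoning

module ℚR = CommutativeRing ℚP.+-*-commutativeRing

-- _≈ₚ_ as a record, so that both sides can be inferred from a proof
infix 4 _≈_
record _≈_ (p r : Poly) : Set where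
  constructor ≈ₚ⇒≈
  field ≈⇒≈ₚ : p ≈ₚ r
open _≈_ public

≈-refl : ∀ {p} → p ≈ p
≈-refl = ≈ₚ⇒≈ λ _ → refl

≈-sym : ∀ {p r} → p ≈ r → r ≈ p
≈-sym e = ≈ₚ⇒≈ λ n → sym (≈⇒≈ₚ e n)

≈-trans : ∀ {p r s} → p ≈ r → r ≈ s → p ≈ s
≈-trans e f = ≈ₚ⇒≈ λ n → trans (≈⇒≈ₚ e n) (≈⇒≈ₚ f n)

≡⇒≈ : ∀ {p r} → p ≡ r → p ≈ r
≡⇒≈ refl = ≈-refl

scale : ℚ → Poly → Poly
scale a = map (a ℚ.*_)

coeffP-+ₚ : ∀ p r n → coeffP (p +ₚ r) n ≡ coeffP p n ℚ.+ coeffP r n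
coeffP-+ₚ []      r       n       = sym (ℚR.+-identityˡ (coeffP r n))
coeffP-+ₚ (a ∷ p) []      n       = sym (ℚR.+-identityʳ (coeffP (a ∷ p) n))
coeffP-+ₚ (a ∷ p) (b ∷ r) zero    = refl
coeffP-+ₚ (a ∷ p) (b ∷ r) (suc n) = coeffP-+ₚ p r n

coeffP-scale : ∀ a r n → coeffP (scale a r) n ≡ a ℚ.* coeffP r n
coeffP-scale a []      n       = sym (ℚR.zeroʳ a)
coeffP-scale a (b ∷ r) zero    = refl
coeffP-scale a (b ∷ r) (suc n) = coeffP-scale a r n

-- (f ⋆ g) n = Σ_{i ≤ n} f i · g (n ∸ i)
_⋆_ : (ℕ → ℚ) → (ℕ → ℚ) → ℕ → ℚ
(f ⋆ g) zero    = f 0 ℚ.* g 0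
(f ⋆ g) (suc n) = f 0 ℚ.* g (suc n) ℚ.+ ((λ i → f (suc i)) ⋆ g) n

⋆-cong : ∀ {f f′ g g′} → (∀ i → f i ≡ f′ i) → (∀ i → g i ≡ g′ i) → ∀ n → (f ⋆ g) n ≡ (f′ ⋆ g′) n
⋆-cong ef eg zero    = cong₂ ℚ._*_ (ef 0) (eg 0)
⋆-cong ef eg (suc n) = cong₂ ℚ._+_ (cong₂ ℚ._*_ (ef 0) (eg (suc n))) (⋆-cong (λ i → ef (suc i)) eg n)

⋆-zeroˡ : ∀ g n → ((λ _ → 0ℚ) ⋆ g) n ≡ 0ℚ
⋆-zeroˡ g zero    = ℚR.zeroˡ (g 0)
⋆-zeroˡ g (suc n) = trans (cong₂ ℚ._+_ (ℚR.zeroˡ (g (suc n))) (⋆-zeroˡ g n)) (ℚR.+-identityˡ 0ℚ)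

coeffP-*ₚ : ∀ p r n → coeffP (p *ₚ r) n ≡ (coeffP p ⋆ coeffP r) n
coeffP-*ₚ []      r n       = sym (⋆-zeroˡ (coeffP r) n)
coeffP-*ₚ (a ∷ p) r zero    = begin
  coeffP (scale a r +ₚ (0ℚ ∷ (p *ₚ r))) 0 ≡⟨ coeffP-+ₚ (scale a r) (0ℚ ∷ (p *ₚ r)) 0 ⟩
  coeffP (scale a r) 0 ℚ.+ 0ℚ             ≡⟨ ℚR.+-identityʳ _ ⟩
  coeffP (scale a r) 0                    ≡⟨ coeffP-scale a r 0 ⟩
  a ℚ.* coeffP r 0                        ∎
  where open ≡-Reasoning
coeffP-*ₚ (a ∷ p) r (suc n) = trans (coeffP-+ₚ (scale a r) (0ℚ ∷ (p *ₚ r)) (suc n))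
  (cong₂ ℚ._+_ (coeffP-scale a r (suc n)) (coeffP-*ₚ p r n))

+ₚ-cong : ∀ {p p′ r r′} → p ≈ p′ → r ≈ r′ → p +ₚ r ≈ p′ +ₚ r′
+ₚ-cong {p} {p′} {r} {r′} e f = ≈ₚ⇒≈ λ n →
  trans (coeffP-+ₚ p r n) (trans (cong₂ ℚ._+_ (≈⇒≈ₚ e n) (≈⇒≈ₚ f n)) (sym (coeffP-+ₚ p′ r′ n)))

*ₚ-cong : ∀ {p p′ r r′} → p ≈ p′ → r ≈ r′ → p *ₚ r ≈ p′ *ₚ r′
*ₚ-cong {p} {p′} {r} {r′} e f = ≈ₚ⇒≈ λ n →
  trans (coeffP-*ₚ p r n) (trans (⋆-cong (≈⇒≈ₚ e) (≈⇒≈ₚ f) n) (sym (coeffP-*ₚ p′ r′ n)))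

∷-cong : ∀ {a b p r} → a ≡ b → p ≈ r → a ∷ p ≈ b ∷ r
∷-cong e f = ≈ₚ⇒≈ λ { zero → e ; (suc n) → ≈⇒≈ₚ f n }

∷-injectiveʳ : ∀ {a b p r} → a ∷ p ≈ b ∷ r → p ≈ r
∷-injectiveʳ e = ≈ₚ⇒≈ λ n → ≈⇒≈ₚ e (suc n)

0∷-zero : ∀ {p} → p ≈ [] → 0ℚ ∷ p ≈ []
0∷-zero e = ≈ₚ⇒≈ λ { zero → refl ; (suc n) → ≈⇒≈ₚ e n }

+ₚ-assoc : ∀ p r s → (p +ₚ r) +ₚ s ≈ p +ₚ (r +ₚ s)
+ₚ-assoc p r s = ≈ₚ⇒≈ λ n → begin
  coeffP ((p +ₚ r) +ₚ s) n                   ≡⟨ coeffP-+ₚ (p +ₚ r) s n ⟩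
  coeffP (p +ₚ r) n ℚ.+ coeffP s n           ≡⟨ cong (ℚ._+ coeffP s n) (coeffP-+ₚ p r n) ⟩
  (coeffP p n ℚ.+ coeffP r n) ℚ.+ coeffP s n ≡⟨ ℚR.+-assoc (coeffP p n) (coeffP r n) (coeffP s n) ⟩
  coeffP p n ℚ.+ (coeffP r n ℚ.+ coeffP s n) ≡⟨ cong (coeffP p n ℚ.+_) (coeffP-+ₚ r s n) ⟨
  coeffP p n ℚ.+ coeffP (r +ₚ s) n           ≡⟨ coeffP-+ₚ p (r +ₚ s) n ⟨
  coeffP (p +ₚ (r +ₚ s)) n                   ∎
  where open ≡-Reasoning

+ₚ-comm : ∀ p r → p +ₚ r ≈ r +ₚ p
+ₚ-comm p r = ≈ₚ⇒≈ λ n →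
  trans (coeffP-+ₚ p r n) (trans (ℚR.+-comm (coeffP p n) (coeffP r n)) (sym (coeffP-+ₚ r p n)))

+ₚ-identityʳ : ∀ p → p +ₚ [] ≈ p
+ₚ-identityʳ p = ≈ₚ⇒≈ λ n → trans (coeffP-+ₚ p [] n) (ℚR.+-identityʳ (coeffP p n))

+ₚ-commutativeMonoid : CommutativeMonoid _ _
+ₚ-commutativeMonoid = record
  { isCommutativeMonoid = record
    { isMonoid = record
      { isSemigroup = record
        { isMagma = record
          { isEquivalence = record { refl = ≈-refl ; sym = ≈-sym ; trans = ≈-trans }
          ; ∙-cong = +ₚ-cong }
        ; assoc = +ₚ-assoc }
      ; identity = (λ _ → ≈-refl) , +ₚ-identityʳ }
    ; comm = +ₚ-comm } }

open CommutativeMonoidSolver +ₚ-commutativeMonoid using (_⊕_; _⊜_) renaming (solve to +ₚ-solve)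

scale-+ₚ : ∀ a p r → scale a (p +ₚ r) ≈ scale a p +ₚ scale a r
scale-+ₚ a p r = ≈ₚ⇒≈ λ n → begin
  coeffP (scale a (p +ₚ r)) n                          ≡⟨ coeffP-scale a (p +ₚ r) n ⟩
  a ℚ.* coeffP (p +ₚ r) n                              ≡⟨ cong (a ℚ.*_) (coeffP-+ₚ p r n) ⟩
  a ℚ.* (coeffP p n ℚ.+ coeffP r n)                    ≡⟨ ℚR.distribˡ a (coeffP p n) (coeffP r n) ⟩
  a ℚ.* coeffP p n ℚ.+ a ℚ.* coeffP r n                ≡⟨ cong₂ ℚ._+_ (coeffP-scale a p n) (coeffP-scale a r n) ⟨
  coeffP (scale a p) n ℚ.+ coeffP (scale a r) n        ≡⟨ coeffP-+ₚ (scale a p) (scale a r) n ⟨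
  coeffP (scale a p +ₚ scale a r) n                    ∎
  where open ≡-Reasoning

+-scale : ∀ a b r → scale (a ℚ.+ b) r ≈ scale a r +ₚ scale b r
+-scale a b r = ≈ₚ⇒≈ λ n → begin
  coeffP (scale (a ℚ.+ b) r) n                         ≡⟨ coeffP-scale (a ℚ.+ b) r n ⟩
  (a ℚ.+ b) ℚ.* coeffP r n                             ≡⟨ ℚR.distribʳ (coeffP r n) a b ⟩
  a ℚ.* coeffP r n ℚ.+ b ℚ.* coeffP r n                ≡⟨ cong₂ ℚ._+_ (coeffP-scale a r n) (coeffP-scale b r n) ⟨
  coeffP (scale a r) n ℚ.+ coeffP (scale b r) n        ≡⟨ coeffP-+ₚ (scale a r) (scale b r) n ⟨
  coeffP (scale a r +ₚ scale b r) n                    ∎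
  where open ≡-Reasoning

scale-scale : ∀ a b r → scale a (scale b r) ≈ scale (a ℚ.* b) r
scale-scale a b r = ≈ₚ⇒≈ λ n → begin
  coeffP (scale a (scale b r)) n ≡⟨ coeffP-scale a (scale b r) n ⟩
  a ℚ.* coeffP (scale b r) n     ≡⟨ cong (a ℚ.*_) (coeffP-scale b r n) ⟩
  a ℚ.* (b ℚ.* coeffP r n)       ≡⟨ ℚR.*-assoc a b (coeffP r n) ⟨
  (a ℚ.* b) ℚ.* coeffP r n       ≡⟨ coeffP-scale (a ℚ.* b) r n ⟨
  coeffP (scale (a ℚ.* b) r) n   ∎
  where open ≡-Reasoning

scale-identity : ∀ r → scale 1ℚ r ≈ r
scale-identity r = ≈ₚ⇒≈ λ n → trans (coeffP-scale 1ℚ r n) (ℚR.*-identityˡ (coeffP r n))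

scale-zero : ∀ r → scale 0ℚ r ≈ []
scale-zero r = ≈ₚ⇒≈ λ n → trans (coeffP-scale 0ℚ r n) (ℚR.zeroˡ (coeffP r n))

*ₚ-zeroʳ : ∀ r → r *ₚ [] ≈ []
*ₚ-zeroʳ []      = ≈-refl
*ₚ-zeroʳ (a ∷ r) = 0∷-zero (*ₚ-zeroʳ r)

0∷-*ₚ : ∀ p r → (0ℚ ∷ p) *ₚ r ≈ 0ℚ ∷ (p *ₚ r)
0∷-*ₚ p r = +ₚ-cong (scale-zero r) ≈-refl

*ₚ-∷ : ∀ p b r → p *ₚ (b ∷ r) ≈ scale b p +ₚ (0ℚ ∷ (p *ₚ r))
*ₚ-∷ []      b r = ≈-sym (0∷-zero ≈-refl)
*ₚ-∷ (a ∷ p) b r = ∷-cong (cong (ℚ._+ 0ℚ) (ℚR.*-comm a b))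
  (≈-trans (+ₚ-cong (≈-refl {scale a r}) (*ₚ-∷ p b r))
    (+ₚ-solve 3 (λ A B C → A ⊕ (B ⊕ C) ⊜ B ⊕ (A ⊕ C)) ≈-refl (scale a r) (scale b p) (0ℚ ∷ (p *ₚ r))))

*ₚ-comm : ∀ p r → p *ₚ r ≈ r *ₚ p
*ₚ-comm []      r       = ≈-sym (*ₚ-zeroʳ r)
*ₚ-comm (a ∷ p) []      = *ₚ-zeroʳ (a ∷ p)
*ₚ-comm (a ∷ p) (b ∷ r) = ∷-cong (cong (ℚ._+ 0ℚ) (ℚR.*-comm a b)) (begin
  scale a r +ₚ (p *ₚ (b ∷ r))                 ≈⟨ +ₚ-cong ≈-refl (*ₚ-∷ p b r) ⟩
  scale a r +ₚ (scale b p +ₚ (0ℚ ∷ (p *ₚ r))) ≈⟨ +ₚ-cong (≈-refl {scale a r}) (+ₚ-cong (≈-refl {scale b p}) (∷-cong refl (*ₚ-comm p r))) ⟩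
  scale a r +ₚ (scale b p +ₚ (0ℚ ∷ (r *ₚ p))) ≈⟨ +ₚ-solve 3 (λ A B C → A ⊕ (B ⊕ C) ⊜ B ⊕ (A ⊕ C)) ≈-refl
                                                   (scale a r) (scale b p) (0ℚ ∷ (r *ₚ p)) ⟩
  scale b p +ₚ (scale a r +ₚ (0ℚ ∷ (r *ₚ p))) ≈⟨ +ₚ-cong ≈-refl (*ₚ-∷ r a p) ⟨
  scale b p +ₚ (r *ₚ (a ∷ p))                 ∎)
  where open SetoidReasoning (CommutativeMonoid.setoid +ₚ-commutativeMonoid)

*ₚ-distribʳ : ∀ r p p′ → (p +ₚ p′) *ₚ r ≈ (p *ₚ r) +ₚ (p′ *ₚ r)
*ₚ-distribʳ r []      p′       = ≈-refl
*ₚ-distribʳ r (a ∷ p) []       = ≈-sym (+ₚ-identityʳ ((a ∷ p) *ₚ r))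
*ₚ-distribʳ r (a ∷ p) (b ∷ p′) =
  ≈-trans (+ₚ-cong (+-scale a b r) (∷-cong (sym (ℚR.+-identityʳ 0ℚ)) (*ₚ-distribʳ r p p′)))
    (+ₚ-solve 4 (λ A B C D → (A ⊕ B) ⊕ (C ⊕ D) ⊜ (A ⊕ C) ⊕ (B ⊕ D)) ≈-refl
      (scale a r) (scale b r) (0ℚ ∷ (p *ₚ r)) (0ℚ ∷ (p′ *ₚ r)))

*ₚ-identityˡ : ∀ r → (1ℚ ∷ []) *ₚ r ≈ r
*ₚ-identityˡ r = ≈-trans (+ₚ-cong (scale-identity r) (0∷-zero ≈-refl)) (+ₚ-identityʳ r)

*ₚ-identityʳ : ∀ r → r *ₚ (1ℚ ∷ []) ≈ r
*ₚ-identityʳ r = ≈-trans (*ₚ-comm r (1ℚ ∷ [])) (*ₚ-identityˡ r)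

scale-*ₚ : ∀ a r s → scale a r *ₚ s ≈ scale a (r *ₚ s)
scale-*ₚ a []      s = ≈-refl
scale-*ₚ a (b ∷ r) s = ≈-trans
  (+ₚ-cong (≈-sym (scale-scale a b s)) (∷-cong (sym (ℚR.zeroʳ a)) (scale-*ₚ a r s)))
  (≈-sym (scale-+ₚ a (scale b s) (0ℚ ∷ (r *ₚ s))))

*ₚ-assoc : ∀ p r s → (p *ₚ r) *ₚ s ≈ p *ₚ (r *ₚ s)
*ₚ-assoc []      r s = ≈-refl
*ₚ-assoc (a ∷ p) r s = ≈-trans (*ₚ-distribʳ s (scale a r) (0ℚ ∷ (p *ₚ r)))
  (+ₚ-cong (scale-*ₚ a r s) (≈-trans (0∷-*ₚ (p *ₚ r) s) (∷-cong refl (*ₚ-assoc p r s))))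

ℚ[q] : CommutativeSemiring _ _
ℚ[q] = record { isCommutativeSemiring = isCommutativeSemiringˡ record
  { +-isCommutativeMonoid = CommutativeMonoid.isCommutativeMonoid +ₚ-commutativeMonoid
  ; *-isCommutativeMonoid = record
    { isMonoid = record
      { isSemigroup = record
        { isMagma = record
          { isEquivalence = record { refl = ≈-refl ; sym = ≈-sym ; trans = ≈-trans }
          ; ∙-cong = *ₚ-cong }
        ; assoc = *ₚ-assoc }
      ; identity = *ₚ-identityˡ , *ₚ-identityʳ }
    ; comm = *ₚ-comm }
  ; distribʳ = *ₚ-distribʳ
  ; zeroˡ = λ _ → ≈-refl } }

open SemiringSolver ℚ[q] using (_:=_; _:+_; _:*_) renaming (solve to ℚ[q]-solve)
module ℚ[q]-Reasoning = SetoidReasoning (CommutativeSemiring.setoid ℚ[q])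
open import Algebra.Properties.CommutativeSemigroup (CommutativeSemiring.*-commutativeSemigroup ℚ[q])
  using (interchange; xy∙z≈xz∙y)

+ₚ-congˡ : ∀ p {r r′} → r ≈ r′ → p +ₚ r ≈ p +ₚ r′
+ₚ-congˡ p e = +ₚ-cong (≈-refl {p}) e

+ₚ-congʳ : ∀ r {p p′} → p ≈ p′ → p +ₚ r ≈ p′ +ₚ r
+ₚ-congʳ r e = +ₚ-cong e (≈-refl {r})

*ₚ-congˡ : ∀ p {r r′} → r ≈ r′ → p *ₚ r ≈ p *ₚ r′
*ₚ-congˡ p e = *ₚ-cong (≈-refl {p}) e

*ₚ-congʳ : ∀ r {p p′} → p ≈ p′ → p *ₚ r ≈ p′ *ₚ r
*ₚ-congʳ r e = *ₚ-cong e (≈-refl {r})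

toℚ : ℤ → ℚ
toℚ z = z ℚ./ 1

toℚ≡fromℤ : ∀ z → toℚ z ≡ fromℤ z
toℚ≡fromℤ (ℤ.+ n)      = ℚP.normalize-coprime {n} {0} _
toℚ≡fromℤ (ℤ.-[1+ m ]) = cong ℚ.-_ (ℚP.normalize-coprime {suc m} {0} _)

toℚ-+ : ∀ a b → toℚ (a ℤ.+ b) ≡ toℚ a ℚ.+ toℚ b
toℚ-+ a b = trans (cong (ℚ._/ 1) (cong₂ ℤ._+_ (sym (ℤP.*-identityʳ a)) (sym (ℤP.*-identityʳ b))))
  (sym (cong₂ ℚ._+_ (toℚ≡fromℤ a) (toℚ≡fromℤ b)))

toℚ-* : ∀ a b → toℚ (a ℤ.* b) ≡ toℚ a ℚ.* toℚ b
toℚ-* a b = sym (cong₂ ℚ._*_ (toℚ≡fromℤ a) (toℚ≡fromℤ b))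

const : ℚ → Poly
const a = a ∷ []

-1ℚ : ℚ
-1ℚ = ℚ.- 1ℚ

const-*ₚ : ∀ a b → const a *ₚ const b ≈ const (a ℚ.* b)
const-*ₚ a b = ≈ₚ⇒≈ λ { zero → ℚR.+-identityʳ (a ℚ.* b) ; (suc zero) → refl ; (suc (suc n)) → refl }

const-toℚ-*ₚ : ∀ a b → const (toℚ a) *ₚ const (toℚ b) ≈ const (toℚ (a ℤ.* b))
const-toℚ-*ₚ a b = ≈-trans (const-*ₚ (toℚ a) (toℚ b)) (≡⇒≈ (cong const (sym (toℚ-* a b))))

scale≈const-*ₚ : ∀ a p → scale a p ≈ const a *ₚ p
scale≈const-*ₚ a p = ≈-sym (≈-trans (+ₚ-congˡ (scale a p) (0∷-zero ≈-refl)) (+ₚ-identityʳ (scale a p)))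

map-neg≈-1-*ₚ : ∀ p → map ℚ.-_ p ≈ const -1ℚ *ₚ p
map-neg≈-1-*ₚ p = ≈-trans (≈ₚ⇒≈ λ n → trans (coeffP-neg p n) (sym (coeffP-scale -1ℚ p n))) (scale≈const-*ₚ -1ℚ p)
  where
  coeffP-neg : ∀ p n → coeffP (map ℚ.-_ p) n ≡ -1ℚ ℚ.* coeffP p n
  coeffP-neg []      n       = refl
  coeffP-neg (a ∷ p) zero    = trans (cong ℚ.-_ (sym (ℚR.*-identityˡ a))) (ℚP.neg-distribˡ-* 1ℚ a)
  coeffP-neg (a ∷ p) (suc n) = coeffP-neg p n

infix 25 q^_
q^_ : ℕ → Poly
q^ zero  = const 1ℚ
q^ suc n = 0ℚ ∷ q^ n

q^-+ : ∀ m n → q^ (m + n) ≈ q^ m *ₚ q^ n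
q^-+ zero    n = ≈-sym (*ₚ-identityˡ (q^ n))
q^-+ (suc m) n = ≈-trans (∷-cong refl (q^-+ m n)) (≈-sym (0∷-*ₚ (q^ m) (q^ n)))

*ₚ-q^-cancelʳ : ∀ n {A B} → A *ₚ q^ n ≈ B *ₚ q^ n → A ≈ B
*ₚ-q^-cancelʳ zero    {A} {B} e = ≈-trans (≈-sym (*ₚ-identityʳ A)) (≈-trans e (*ₚ-identityʳ B))
*ₚ-q^-cancelʳ (suc n) {A} {B} e =
  *ₚ-q^-cancelʳ n (∷-injectiveʳ (≈-trans (≈-sym (shift A)) (≈-trans e (shift B))))
  where
  shift : ∀ X → X *ₚ q^ suc n ≈ 0ℚ ∷ (X *ₚ q^ n)
  shift X = ≈-trans (*ₚ-comm X (q^ suc n)) (≈-trans (0∷-*ₚ (q^ n) X) (∷-cong refl (*ₚ-comm (q^ n) X)))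

denominator : Qq → Poly
denominator x = prodDen (den x)

prodDen-++ : ∀ a b → prodDen (a ++ b) ≈ prodDen a *ₚ prodDen b
prodDen-++ []      b = ≈-sym (*ₚ-identityˡ (prodDen b))
prodDen-++ (d ∷ a) b = ≈-trans (*ₚ-congˡ (proj₁ d) (prodDen-++ a b))
  (≈-sym (*ₚ-assoc (proj₁ d) (prodDen a) (prodDen b)))

-- equality of numerators and of denominators: finer than _≈q_, but evidently transitive
infix 4 _≅_
record _≅_ (x y : Qq) : Set where
  constructor _,_
  field
    num-≈ : num x ≈ num y
    den-≈ : denominator x ≈ denominator y
open _≅_ public

≅-refl : ∀ {x} → x ≅ x
≅-refl = ≈-refl , ≈-refl

≅-sym : ∀ {x y} → x ≅ y → y ≅ x
≅-sym (a , b) = ≈-sym a , ≈-sym b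

≅-trans : ∀ {x y z} → x ≅ y → y ≅ z → x ≅ z
≅-trans (a , b) (c , d) = ≈-trans a c , ≈-trans b d

≅-setoid : Setoid _ _
≅-setoid = record
  { Carrier = Qq ; _≈_ = _≅_ ; isEquivalence = record { refl = ≅-refl ; sym = ≅-sym ; trans = ≅-trans } }

module ≅-Reasoning = SetoidReasoning ≅-setoid

+q-cong : ∀ {x x′ y y′} → x ≅ x′ → y ≅ y′ → x +q y ≅ x′ +q y′
+q-cong {x} {x′} {y} {y′} (a , b) (c , d) =
  +ₚ-cong (*ₚ-cong a d) (*ₚ-cong c b) ,
  ≈-trans (prodDen-++ (den x) (den y)) (≈-trans (*ₚ-cong b d) (≈-sym (prodDen-++ (den x′) (den y′))))

+q-assoc : ∀ x y z → (x +q y) +q z ≅ x +q (y +q z)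
+q-assoc x y z = numerators , ≡⇒≈ (cong prodDen (++-assoc (den x) (den y) (den z)))
  where
  open ℚ[q]-Reasoning
  X = num x ; Y = num y ; Z = num z
  Dx = denominator x ; Dy = denominator y ; Dz = denominator z
  numerators : num ((x +q y) +q z) ≈ num (x +q (y +q z))
  numerators = begin
    (((X *ₚ Dy) +ₚ (Y *ₚ Dx)) *ₚ Dz) +ₚ (Z *ₚ prodDen (den x ++ den y))
      ≈⟨ +ₚ-congˡ (((X *ₚ Dy) +ₚ (Y *ₚ Dx)) *ₚ Dz) (*ₚ-congˡ Z (prodDen-++ (den x) (den y))) ⟩
    (((X *ₚ Dy) +ₚ (Y *ₚ Dx)) *ₚ Dz) +ₚ (Z *ₚ (Dx *ₚ Dy))
      ≈⟨ ℚ[q]-solve 6 (λ X Dy Y Dx Z Dz → (((X :* Dy) :+ (Y :* Dx)) :* Dz) :+ (Z :* (Dx :* Dy))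
                      := (X :* (Dy :* Dz)) :+ (((Y :* Dz) :+ (Z :* Dy)) :* Dx)) ≈-refl X Dy Y Dx Z Dz ⟩
    (X *ₚ (Dy *ₚ Dz)) +ₚ (((Y *ₚ Dz) +ₚ (Z *ₚ Dy)) *ₚ Dx)
      ≈⟨ +ₚ-congʳ (((Y *ₚ Dz) +ₚ (Z *ₚ Dy)) *ₚ Dx) (*ₚ-congˡ X (prodDen-++ (den y) (den z))) ⟨
    (X *ₚ prodDen (den y ++ den z)) +ₚ (((Y *ₚ Dz) +ₚ (Z *ₚ Dy)) *ₚ Dx) ∎

0q-+q : ∀ x → 0q +q x ≅ x
0q-+q x = *ₚ-identityʳ (num x) , ≈-refl

poly : Poly → Qq
poly p = p ÷ []

poly-*q-distrib : ∀ p x y → poly p *q (x +q y) ≅ (poly p *q x) +q (poly p *q y)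
poly-*q-distrib p x y =
  ℚ[q]-solve 5 (λ p X Dy Y Dx → p :* ((X :* Dy) :+ (Y :* Dx)) := ((p :* X) :* Dy) :+ ((p :* Y) :* Dx))
    ≈-refl p (num x) (denominator y) (num y) (denominator x) , ≈-refl

poly-*q-0q : ∀ p → poly p *q 0q ≅ 0q
poly-*q-0q p = *ₚ-zeroʳ p , ≈-refl

poly-*q-assoc : ∀ p x y → (poly p *q x) *q y ≅ poly p *q (x *q y)
poly-*q-assoc p x y = *ₚ-assoc p (num x) (num y) , ≈-refl

infix 4 _≐_/q^_
record _≐_/q^_ (x : Qq) (P : Poly) (n : ℕ) : Set where
  constructor ≐-intro
  field ≐-elim : num x *ₚ q^ n ≈ P *ₚ denominator x
open _≐_/q^_ public

≐-resp-≅ : ∀ {n x y P} → x ≅ y → x ≐ P /q^ n → y ≐ P /q^ n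
≐-resp-≅ {n} {x} {y} {P} (a , b) (≐-intro e) = ≐-intro (begin
  num y *ₚ q^ n        ≈⟨ *ₚ-congʳ (q^ n) (≈-sym a) ⟩
  num x *ₚ q^ n        ≈⟨ e ⟩
  P *ₚ denominator x   ≈⟨ *ₚ-congˡ P b ⟩
  P *ₚ denominator y   ∎)
  where open ℚ[q]-Reasoning

≐-resp-≈ : ∀ {n x P P′} → P ≈ P′ → x ≐ P /q^ n → x ≐ P′ /q^ n
≐-resp-≈ {x = x} e (≐-intro v) = ≐-intro (≈-trans v (*ₚ-congʳ (denominator x) e))

≐-+q : ∀ {n x y P R} → x ≐ P /q^ n → y ≐ R /q^ n → x +q y ≐ P +ₚ R /q^ n
≐-+q {n} {x} {y} {P} {R} (≐-intro vx) (≐-intro vy) = ≐-intro (begin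
  ((num x *ₚ Dy) +ₚ (num y *ₚ Dx)) *ₚ q^ n
    ≈⟨ ℚ[q]-solve 5 (λ X Dy Y Dx Q → ((X :* Dy) :+ (Y :* Dx)) :* Q := ((X :* Q) :* Dy) :+ ((Y :* Q) :* Dx))
         ≈-refl (num x) Dy (num y) Dx (q^ n) ⟩
  ((num x *ₚ q^ n) *ₚ Dy) +ₚ ((num y *ₚ q^ n) *ₚ Dx)
    ≈⟨ +ₚ-cong (*ₚ-congʳ Dy vx) (*ₚ-congʳ Dx vy) ⟩
  ((P *ₚ Dx) *ₚ Dy) +ₚ ((R *ₚ Dy) *ₚ Dx)
    ≈⟨ ℚ[q]-solve 4 (λ P Dx Dy R → ((P :* Dx) :* Dy) :+ ((R :* Dy) :* Dx) := (P :+ R) :* (Dx :* Dy))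
         ≈-refl P Dx Dy R ⟩
  (P +ₚ R) *ₚ (Dx *ₚ Dy)
    ≈⟨ *ₚ-congˡ (P +ₚ R) (prodDen-++ (den x) (den y)) ⟨
  (P +ₚ R) *ₚ denominator (x +q y) ∎)
  where
  open ℚ[q]-Reasoning
  Dx = denominator x ; Dy = denominator y

≐-*q : ∀ {m n x y P R} → x ≐ P /q^ m → y ≐ R /q^ n → x *q y ≐ P *ₚ R /q^ (m + n)
≐-*q {m} {n} {x} {y} {P} {R} (≐-intro vx) (≐-intro vy) = ≐-intro (begin
  (num x *ₚ num y) *ₚ q^ (m + n)     ≈⟨ *ₚ-congˡ (num x *ₚ num y) (q^-+ m n) ⟩
  (num x *ₚ num y) *ₚ (q^ m *ₚ q^ n) ≈⟨ interchange (num x) (num y) (q^ m) (q^ n) ⟩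
  (num x *ₚ q^ m) *ₚ (num y *ₚ q^ n) ≈⟨ *ₚ-cong vx vy ⟩
  (P *ₚ Dx) *ₚ (R *ₚ Dy)             ≈⟨ interchange P Dx R Dy ⟩
  (P *ₚ R) *ₚ (Dx *ₚ Dy)             ≈⟨ *ₚ-congˡ (P *ₚ R) (prodDen-++ (den x) (den y)) ⟨
  (P *ₚ R) *ₚ denominator (x *q y)   ∎)
  where
  open ℚ[q]-Reasoning
  Dx = denominator x ; Dy = denominator y

≐--q : ∀ {n x P} → x ≐ P /q^ n → -q x ≐ const -1ℚ *ₚ P /q^ n
≐--q {n} {x} {P} (≐-intro v) = ≐-intro (begin
  map ℚ.-_ (num x) *ₚ q^ n       ≈⟨ *ₚ-congʳ (q^ n) (map-neg≈-1-*ₚ (num x)) ⟩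
  (const -1ℚ *ₚ num x) *ₚ q^ n   ≈⟨ *ₚ-assoc (const -1ℚ) (num x) (q^ n) ⟩
  const -1ℚ *ₚ (num x *ₚ q^ n)   ≈⟨ *ₚ-congˡ (const -1ℚ) v ⟩
  const -1ℚ *ₚ (P *ₚ Dx)         ≈⟨ *ₚ-assoc (const -1ℚ) P Dx ⟨
  (const -1ℚ *ₚ P) *ₚ Dx         ∎)
  where
  open ℚ[q]-Reasoning
  Dx = denominator x

≐-shift : ∀ {m n x P} → x ≐ P /q^ n → x ≐ P *ₚ q^ m /q^ (n + m)
≐-shift {m} {n} {x} {P} (≐-intro v) = ≐-intro (begin
  num x *ₚ q^ (n + m)         ≈⟨ *ₚ-congˡ (num x) (q^-+ n m) ⟩
  num x *ₚ (q^ n *ₚ q^ m)     ≈⟨ *ₚ-assoc (num x) (q^ n) (q^ m) ⟨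
  (num x *ₚ q^ n) *ₚ q^ m     ≈⟨ *ₚ-congʳ (q^ m) v ⟩
  (P *ₚ denominator x) *ₚ q^ m ≈⟨ xy∙z≈xz∙y P (denominator x) (q^ m) ⟩
  (P *ₚ q^ m) *ₚ denominator x ∎)
  where open ℚ[q]-Reasoning

≐-unshift : ∀ {m n x P} → x ≐ P *ₚ q^ m /q^ (n + m) → x ≐ P /q^ n
≐-unshift {m} {n} {x} {P} (≐-intro v) = ≐-intro (*ₚ-q^-cancelʳ m (begin
  (num x *ₚ q^ n) *ₚ q^ m      ≈⟨ *ₚ-assoc (num x) (q^ n) (q^ m) ⟩
  num x *ₚ (q^ n *ₚ q^ m)      ≈⟨ *ₚ-congˡ (num x) (q^-+ n m) ⟨
  num x *ₚ q^ (n + m)          ≈⟨ v ⟩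
  (P *ₚ q^ m) *ₚ denominator x ≈⟨ xy∙z≈xz∙y P (q^ m) (denominator x) ⟩
  (P *ₚ denominator x) *ₚ q^ m ∎))
  where open ℚ[q]-Reasoning

≐-unique : ∀ {x y P} → x ≐ P /q^ 0 → y ≐ P /q^ 0 → x ≈q y
≐-unique {x} {y} {P} (≐-intro vx) (≐-intro vy) = ≈⇒≈ₚ (begin
  num x *ₚ Dy               ≈⟨ *ₚ-congʳ Dy (*ₚ-identityʳ (num x)) ⟨
  (num x *ₚ q^ 0) *ₚ Dy     ≈⟨ *ₚ-congʳ Dy vx ⟩
  (P *ₚ Dx) *ₚ Dy           ≈⟨ xy∙z≈xz∙y P Dx Dy ⟩
  (P *ₚ Dy) *ₚ Dx           ≈⟨ *ₚ-congʳ Dx vy ⟨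
  (num y *ₚ q^ 0) *ₚ Dx     ≈⟨ *ₚ-congʳ Dx (*ₚ-identityʳ (num y)) ⟩
  num y *ₚ Dx               ∎)
  where
  open ℚ[q]-Reasoning
  Dx = denominator x ; Dy = denominator y

≈q-poly⇒≐ : ∀ {p y} → poly p ≈q y → y ≐ p /q^ 0
≈q-poly⇒≐ {p} {y} e = ≐-intro (begin
  num y *ₚ q^ 0          ≈⟨ *ₚ-identityʳ (num y) ⟩
  num y                  ≈⟨ *ₚ-identityʳ (num y) ⟨
  num y *ₚ const 1ℚ      ≈⟨ ≈-sym (≈ₚ⇒≈ e) ⟩
  p *ₚ denominator y     ∎)
  where open ℚ[q]-Reasoning

q : Qq
q = poly (q^ 1)

0q-≐ : ∀ {n} → 0q ≐ [] /q^ n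
0q-≐ = ≐-intro ≈-refl

poly-≐ : ∀ p → poly p ≐ p /q^ 0
poly-≐ p = ≐-intro ≈-refl

q⁻¹-≐ : q⁻¹ ≐ const 1ℚ /q^ 1
q⁻¹-≐ = ≐-intro (*ₚ-congˡ (const 1ℚ) (≈-sym (*ₚ-identityʳ (q^ 1))))

module FreeAlgCoeff (R : Set) (0r : R) (_+r_ _*r_ : R → R → R) (_≈r_ : R → R → Set) (N : ℕ) where
  open FreeAlg R 0r _+r_ _*r_ _≈r_ N using (coeff; sandwich)

  coeff-∷-≡ : ∀ c v f {w} → v ≡ w → coeff ((c , v) ∷ f) w ≡ c +r coeff f w
  coeff-∷-≡ c v f {w} v≡w with ≡-dec _≟ᶠ_ v w
  ... | yes _   = refl
  ... | no  v≢w = ⊥-elim (v≢w v≡w)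

  coeff-∷-≢ : ∀ c v f {w} → v ≢ w → coeff ((c , v) ∷ f) w ≡ coeff f w
  coeff-∷-≢ c v f {w} v≢w with ≡-dec _≟ᶠ_ v w
  ... | yes v≡w = ⊥-elim (v≢w v≡w)
  ... | no  _   = refl

  ++-injective-middle : ∀ (x y u v : Word N) → x ++ u ++ y ≡ x ++ v ++ y → u ≡ v
  ++-injective-middle x y u v e = ++-cancelʳ y u v (++-cancelˡ x (u ++ y) (v ++ y) e)

  sandwich-support : ∀ c x g y w → (∃ λ v → w ≡ x ++ v ++ y) ⊎ coeff (sandwich c x g y) w ≡ 0r
  sandwich-support c x []            y w = inj₂ refl
  sandwich-support c x ((d , u) ∷ g) y w with ≡-dec _≟ᶠ_ (x ++ u ++ y) w
  ... | yes e = inj₁ (u , sym e)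
  ... | no  _ = sandwich-support c x g y w

module 𝒰ₚ (N : ℕ) = FreeAlg Poly [] _+ₚ_ _*ₚ_ _≈_ N

module Coefficientwise (N : ℕ) where
  module Q = 𝒰q N
  module Z = 𝒰 N
  module P = 𝒰ₚ N
  module Qᶜ = FreeAlgCoeff Qq 0q _+q_ _*q_ _≈q_ N
  module Pᶜ = FreeAlgCoeff Poly [] _+ₚ_ _*ₚ_ _≈_ N

  imageₚ : Z.Elt → P.Elt
  imageₚ = map (λ { (c , w) → (const (toℚ c) , w) })

  P-coeff-imageₚ : ∀ f w → P.coeff (imageₚ f) w ≈ const (toℚ (Z.coeff f w))
  P-coeff-imageₚ []            w = ≈-sym (0∷-zero ≈-refl)
  P-coeff-imageₚ ((c , v) ∷ f) w with ≡-dec _≟ᶠ_ v w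
  ... | yes _ = ≈-trans (+ₚ-congˡ (const (toℚ c)) (P-coeff-imageₚ f w))
                        (≡⇒≈ (cong const (sym (toℚ-+ c (Z.coeff f w)))))
  ... | no  _ = P-coeff-imageₚ f w

  -- P._≋_ as a record, for the same reason as _≈_
  infix 4 _≋_
  record _≋_ (L L′ : P.Elt) : Set where
    constructor ≋-intro
    field ≋-at : ∀ w → P.coeff L w ≈ P.coeff L′ w
  open _≋_ public

  imageₚ-cong : ∀ {f g} → f Z.≋ g → imageₚ f ≋ imageₚ g
  imageₚ-cong {f} {g} f≋g = ≋-intro λ w →
    ≈-trans (P-coeff-imageₚ f w) (≈-trans (≡⇒≈ (cong (const ∘ toℚ) (f≋g w))) (≈-sym (P-coeff-imageₚ g w)))

  ≋-refl : ∀ {L} → L ≋ L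
  ≋-refl = ≋-intro λ _ → ≈-refl

  ≋-trans : ∀ {L L′ L″} → L ≋ L′ → L′ ≋ L″ → L ≋ L″
  ≋-trans e f = ≋-intro λ w → ≈-trans (≋-at e w) (≋-at f w)

  δ : Word N → Word N → Poly → Poly
  δ v w R with ≡-dec _≟ᶠ_ v w
  ... | yes _ = R
  ... | no  _ = []

  P-coeff-∷ : ∀ R v L w → P.coeff ((R , v) ∷ L) w ≈ δ v w R +ₚ P.coeff L w
  P-coeff-∷ R v L w with ≡-dec _≟ᶠ_ v w
  ... | yes _ = ≈-refl
  ... | no  _ = ≈-refl

  ∷-≋ : ∀ {R R′ L L′} v → R ≈ R′ → L ≋ L′ → (R , v) ∷ L ≋ (R′ , v) ∷ L′
  ∷-≋ {R} {R′} {L} {L′} v e f = ≋-intro at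
    where
    at : ∀ w → P.coeff ((R , v) ∷ L) w ≈ P.coeff ((R′ , v) ∷ L′) w
    at w with ≡-dec _≟ᶠ_ v w
    ... | yes _ = +ₚ-cong e (≋-at f w)
    ... | no  _ = ≋-at f w

  swap-≋ : ∀ R u S v L → (R , u) ∷ (S , v) ∷ L ≋ (S , v) ∷ (R , u) ∷ L
  swap-≋ R u S v L = ≋-intro λ w → begin
    P.coeff ((R , u) ∷ (S , v) ∷ L) w        ≈⟨ P-coeff-∷ R u ((S , v) ∷ L) w ⟩
    δ u w R +ₚ P.coeff ((S , v) ∷ L) w       ≈⟨ +ₚ-congˡ (δ u w R) (P-coeff-∷ S v L w) ⟩
    δ u w R +ₚ (δ v w S +ₚ P.coeff L w)      ≈⟨ +ₚ-solve 3 (λ A B C → A ⊕ (B ⊕ C) ⊜ B ⊕ (A ⊕ C)) ≈-refl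
                                                  (δ u w R) (δ v w S) (P.coeff L w) ⟩
    δ v w S +ₚ (δ u w R +ₚ P.coeff L w)      ≈⟨ +ₚ-congˡ (δ v w S) (P-coeff-∷ R u L w) ⟨
    δ v w S +ₚ P.coeff ((R , u) ∷ L) w       ≈⟨ P-coeff-∷ S v ((R , u) ∷ L) w ⟨
    P.coeff ((S , v) ∷ (R , u) ∷ L) w        ∎
    where open ℚ[q]-Reasoning

  cancel-≋ : ∀ R S u L → R +ₚ S ≈ [] → (R , u) ∷ (S , u) ∷ L ≋ L
  cancel-≋ R S u L R+S≈0 = ≋-intro at
    where
    open ℚ[q]-Reasoning
    δ-cancel : ∀ w → δ u w R +ₚ δ u w S ≈ []
    δ-cancel w with ≡-dec _≟ᶠ_ u w
    ... | yes _ = R+S≈0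
    ... | no  _ = ≈-refl
    at : ∀ w → P.coeff ((R , u) ∷ (S , u) ∷ L) w ≈ P.coeff L w
    at w = begin
      P.coeff ((R , u) ∷ (S , u) ∷ L) w        ≈⟨ P-coeff-∷ R u ((S , u) ∷ L) w ⟩
      δ u w R +ₚ P.coeff ((S , u) ∷ L) w       ≈⟨ +ₚ-congˡ (δ u w R) (P-coeff-∷ S u L w) ⟩
      δ u w R +ₚ (δ u w S +ₚ P.coeff L w)      ≈⟨ +ₚ-assoc (δ u w R) (δ u w S) (P.coeff L w) ⟨
      (δ u w R +ₚ δ u w S) +ₚ P.coeff L w      ≈⟨ +ₚ-congʳ (P.coeff L w) (δ-cancel w) ⟩
      P.coeff L w                              ∎

  infix 4 _≐ᶜ_/q^_
  record _≐ᶜ_/q^_ (F : Q.Elt) (L : P.Elt) (n : ℕ) : Set where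
    constructor ≐ᶜ-intro
    field ≐ᶜ-at : ∀ w → Q.coeff F w ≐ P.coeff L w /q^ n
  open _≐ᶜ_/q^_ public

  ≐ᶜ-resp-≋ : ∀ {n F L L′} → F ≐ᶜ L /q^ n → L ≋ L′ → F ≐ᶜ L′ /q^ n
  ≐ᶜ-resp-≋ v e = ≐ᶜ-intro λ w → ≐-resp-≈ (≋-at e w) (≐ᶜ-at v w)

  ≐ᶜ-resp-≅ : ∀ {n F F′ L} → (∀ w → Q.coeff F w ≅ Q.coeff F′ w) → F ≐ᶜ L /q^ n → F′ ≐ᶜ L /q^ n
  ≐ᶜ-resp-≅ e v = ≐ᶜ-intro λ w → ≐-resp-≅ (e w) (≐ᶜ-at v w)

  Q-coeff-++ : ∀ F G w → Q.coeff (F ++ G) w ≅ Q.coeff F w +q Q.coeff G w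
  Q-coeff-++ []            G w = ≅-sym (0q-+q (Q.coeff G w))
  Q-coeff-++ ((s , v) ∷ F) G w with ≡-dec _≟ᶠ_ v w
  ... | yes _ = ≅-trans (+q-cong (≅-refl {s}) (Q-coeff-++ F G w)) (≅-sym (+q-assoc s (Q.coeff F w) (Q.coeff G w)))
  ... | no  _ = Q-coeff-++ F G w

  P-coeff-++ : ∀ L M w → P.coeff (L ++ M) w ≈ P.coeff L w +ₚ P.coeff M w
  P-coeff-++ []            M w = ≈-refl
  P-coeff-++ ((R , v) ∷ L) M w with ≡-dec _≟ᶠ_ v w
  ... | yes _ = ≈-trans (+ₚ-congˡ R (P-coeff-++ L M w)) (≈-sym (+ₚ-assoc R (P.coeff L w) (P.coeff M w)))
  ... | no  _ = P-coeff-++ L M w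

  ≐ᶜ-++ : ∀ {n F G L M} → F ≐ᶜ L /q^ n → G ≐ᶜ M /q^ n → F ++ G ≐ᶜ L ++ M /q^ n
  ≐ᶜ-++ {F = F} {G} {L} {M} v u = ≐ᶜ-intro λ w →
    ≐-resp-≈ (≈-sym (P-coeff-++ L M w)) (≐-resp-≅ (≅-sym (Q-coeff-++ F G w)) (≐-+q (≐ᶜ-at v w) (≐ᶜ-at u w)))

  Entry≐ : ℕ → Qq × Word N → Poly × Word N → Set
  Entry≐ n (s , v) (R , u) = v ≡ u × s ≐ R /q^ n

  pointwise⇒≐ᶜ : ∀ {n F L} → Pointwise (Entry≐ n) F L → F ≐ᶜ L /q^ n
  pointwise⇒≐ᶜ r = ≐ᶜ-intro (at r)
    where
    at : ∀ {n F L} → Pointwise (Entry≐ n) F L → ∀ w → Q.coeff F w ≐ P.coeff L w /q^ n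
    at []                                                   w = 0q-≐
    at {F = (s , v) ∷ F} {(R , .v) ∷ L} ((refl , e) ∷ r) w with ≡-dec _≟ᶠ_ v w
    ... | yes _ = ≐-+q e (at r w)
    ... | no  _ = at r w

  image-≐ᶜ : ∀ f → image f ≐ᶜ imageₚ f /q^ 0
  image-≐ᶜ f = pointwise⇒≐ᶜ (entries f)
    where
    entries : ∀ f → Pointwise (Entry≐ 0) (image f) (imageₚ f)
    entries []            = []
    entries ((c , v) ∷ f) = (refl , poly-≐ (const (toℚ c))) ∷ entries f

  Entry≅ : Qq × Word N → Qq × Word N → Set
  Entry≅ (s , v) (s′ , v′) = s ≅ s′ × v ≡ v′

  pointwise⇒coeff-≅ : ∀ {F F′} → Pointwise Entry≅ F F′ → ∀ w → Q.coeff F w ≅ Q.coeff F′ w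
  pointwise⇒coeff-≅ []                                                       w = ≅-refl
  pointwise⇒coeff-≅ {(s , v) ∷ F} {(s′ , .v) ∷ F′} ((e , refl) ∷ r) w with ≡-dec _≟ᶠ_ v w
  ... | yes _ = +q-cong e (pointwise⇒coeff-≅ r w)
  ... | no  _ = pointwise⇒coeff-≅ r w

  shiftₚ : ℕ → P.Elt → P.Elt
  shiftₚ m = map (λ { (R , v) → (R *ₚ q^ m , v) })

  P-coeff-shiftₚ : ∀ m L w → P.coeff (shiftₚ m L) w ≈ P.coeff L w *ₚ q^ m
  P-coeff-shiftₚ m []            w = ≈-refl
  P-coeff-shiftₚ m ((R , v) ∷ L) w with ≡-dec _≟ᶠ_ v w
  ... | yes _ = ≈-trans (+ₚ-congˡ (R *ₚ q^ m) (P-coeff-shiftₚ m L w)) (≈-sym (*ₚ-distribʳ (q^ m) R (P.coeff L w)))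
  ... | no  _ = P-coeff-shiftₚ m L w

  ≐ᶜ-unshift : ∀ {m n F L} → F ≐ᶜ shiftₚ m L /q^ (n + m) → F ≐ᶜ L /q^ n
  ≐ᶜ-unshift {m} {L = L} v = ≐ᶜ-intro λ w → ≐-unshift {m} (≐-resp-≈ (P-coeff-shiftₚ m L w) (≐ᶜ-at v w))

  Q-coeff-sandwich : ∀ p x y G v → Q.coeff (Q.sandwich (poly p) x G y) (x ++ v ++ y) ≅ poly p *q Q.coeff G v
  Q-coeff-sandwich p x y []            v = ≅-sym (poly-*q-0q p)
  Q-coeff-sandwich p x y ((e , u) ∷ G) v with ≡-dec _≟ᶠ_ u v
  ... | yes u≡v = begin
    Q.coeff ((poly p *q e , x ++ u ++ y) ∷ S) (x ++ v ++ y)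
      ≡⟨ Qᶜ.coeff-∷-≡ (poly p *q e) (x ++ u ++ y) S (cong (λ z → x ++ z ++ y) u≡v) ⟩
    (poly p *q e) +q Q.coeff S (x ++ v ++ y)      ≈⟨ +q-cong (≅-refl {poly p *q e}) (Q-coeff-sandwich p x y G v) ⟩
    (poly p *q e) +q (poly p *q Q.coeff G v)      ≈⟨ poly-*q-distrib p e (Q.coeff G v) ⟨
    poly p *q (e +q Q.coeff G v)                  ∎
    where
    open ≅-Reasoning
    S = Q.sandwich (poly p) x G y
  ... | no u≢v = begin
    Q.coeff ((poly p *q e , x ++ u ++ y) ∷ S) (x ++ v ++ y)
      ≡⟨ Qᶜ.coeff-∷-≢ (poly p *q e) (x ++ u ++ y) S (u≢v ∘ Qᶜ.++-injective-middle x y u v) ⟩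
    Q.coeff S (x ++ v ++ y)                       ≈⟨ Q-coeff-sandwich p x y G v ⟩
    poly p *q Q.coeff G v                         ∎
    where
    open ≅-Reasoning
    S = Q.sandwich (poly p) x G y

  P-coeff-sandwich : ∀ p x y L v → P.coeff (P.sandwich p x L y) (x ++ v ++ y) ≈ p *ₚ P.coeff L v
  P-coeff-sandwich p x y []            v = ≈-sym (*ₚ-zeroʳ p)
  P-coeff-sandwich p x y ((R , u) ∷ L) v with ≡-dec _≟ᶠ_ u v
  ... | yes u≡v = begin
    P.coeff ((p *ₚ R , x ++ u ++ y) ∷ S) (x ++ v ++ y)
      ≡⟨ Pᶜ.coeff-∷-≡ (p *ₚ R) (x ++ u ++ y) S (cong (λ z → x ++ z ++ y) u≡v) ⟩
    (p *ₚ R) +ₚ P.coeff S (x ++ v ++ y)           ≈⟨ +ₚ-congˡ (p *ₚ R) (P-coeff-sandwich p x y L v) ⟩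
    (p *ₚ R) +ₚ (p *ₚ P.coeff L v)                ≈⟨ ℚ[q]-solve 3 (λ p R C → (p :* R) :+ (p :* C) := p :* (R :+ C))
                                                       ≈-refl p R (P.coeff L v) ⟩
    p *ₚ (R +ₚ P.coeff L v)                       ∎
    where
    open ℚ[q]-Reasoning
    S = P.sandwich p x L y
  ... | no u≢v = begin
    P.coeff ((p *ₚ R , x ++ u ++ y) ∷ S) (x ++ v ++ y)
      ≡⟨ Pᶜ.coeff-∷-≢ (p *ₚ R) (x ++ u ++ y) S (u≢v ∘ Pᶜ.++-injective-middle x y u v) ⟩
    P.coeff S (x ++ v ++ y)                       ≈⟨ P-coeff-sandwich p x y L v ⟩
    p *ₚ P.coeff L v                              ∎
    where
    open ℚ[q]-Reasoning
    S = P.sandwich p x L y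

  ≐-at-sandwich : ∀ {n G L} p x y v → G ≐ᶜ L /q^ n →
    Q.coeff (Q.sandwich (poly p) x G y) (x ++ v ++ y) ≐ P.coeff (P.sandwich p x L y) (x ++ v ++ y) /q^ n
  ≐-at-sandwich {G = G} {L} p x y v G≐L =
    ≐-resp-≅ (≅-sym (Q-coeff-sandwich p x y G v))
      (≐-resp-≈ (≈-sym (P-coeff-sandwich p x y L v)) (≐-*q (poly-≐ p) (≐ᶜ-at G≐L v)))

  ≐ᶜ-sandwich : ∀ {n G L} p x y → G ≐ᶜ L /q^ n → Q.sandwich (poly p) x G y ≐ᶜ P.sandwich p x L y /q^ n
  ≐ᶜ-sandwich {n} {G} {L} p x y G≐L = ≐ᶜ-intro at
    where
    at : ∀ w → Q.coeff (Q.sandwich (poly p) x G y) w ≐ P.coeff (P.sandwich p x L y) w /q^ n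
    at w with Qᶜ.sandwich-support (poly p) x G y w
    ... | inj₁ (v , refl) = ≐-at-sandwich p x y v G≐L
    ... | inj₂ Q≡0 with Pᶜ.sandwich-support p x L y w
    ...   | inj₁ (v , refl) = ≐-at-sandwich p x y v G≐L
    ...   | inj₂ P≡0 = subst₂ (λ a b → a ≐ b /q^ n) (sym Q≡0) (sym P≡0) 0q-≐

  imageₚ-sandwich : ∀ c x g y → P.sandwich (const (toℚ c)) x (imageₚ g) y ≋ imageₚ (Z.sandwich c x g y)
  imageₚ-sandwich c x []            y = ≋-refl
  imageₚ-sandwich c x ((d , v) ∷ g) y   = ∷-≋ (x ++ v ++ y) (const-toℚ-*ₚ c d) (imageₚ-sandwich c x g y)

  imageₚ-++ : ∀ f g → imageₚ (f ++ g) ≡ imageₚ f ++ imageₚ g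
  imageₚ-++ []      g = refl
  imageₚ-++ (e ∷ f) g = cong (_ ∷_) (imageₚ-++ f g)

  sandwich-++ : ∀ C x F G y → Q.sandwich C x (F ++ G) y ≡ Q.sandwich C x F y ++ Q.sandwich C x G y
  sandwich-++ C x []      G y = refl
  sandwich-++ C x (e ∷ F) G y = cong (_ ∷_) (sandwich-++ C x F G y)

  module _ {Gen : Q.Elt → Set} where
    evalTerms-++ : (ts us : List (Q.Term Gen)) → Q.evalTerms (ts ++ us) ≡ Q.evalTerms ts ++ Q.evalTerms us
    evalTerms-++ []                     us = refl
    evalTerms-++ (Q.term s l g r _ ∷ ts) us =
      trans (cong (Q.sandwich s l g r ++_) (evalTerms-++ ts us)) (sym (++-assoc (Q.sandwich s l g r) _ _))

    sandwichTerm : Qq → Word N → Word N → Q.Term Gen → Q.Term Gen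
    sandwichTerm C x y (Q.term s l g r h) = Q.term (C *q s) (x ++ l) g (r ++ y) h

    evalTerms-sandwichTerm : ∀ p x y (ts : List (Q.Term Gen)) →
      Pointwise Entry≅ (Q.evalTerms (map (sandwichTerm (poly p) x y) ts)) (Q.sandwich (poly p) x (Q.evalTerms ts) y)
    evalTerms-sandwichTerm p x y []                      = []
    evalTerms-sandwichTerm p x y (Q.term s l g r _ ∷ ts) =
      subst (Pointwise Entry≅ _) (sym (sandwich-++ (poly p) x (Q.sandwich s l g r) (Q.evalTerms ts) y))
        (Pointwise.++⁺ (entries g) (evalTerms-sandwichTerm p x y ts))
      where
      entries : ∀ g → Pointwise Entry≅ (Q.sandwich (poly p *q s) (x ++ l) g (r ++ y))
                                       (Q.sandwich (poly p) x (Q.sandwich s l g r) y)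
      entries []            = []
      entries ((d , u) ∷ g) = (poly-*q-assoc p s d , word-assoc) ∷ entries g
        where
        word-assoc : (x ++ l) ++ u ++ r ++ y ≡ x ++ (l ++ u ++ r) ++ y
        word-assoc = trans (++-assoc x l (u ++ r ++ y))
          (cong (x ++_) (sym (trans (++-assoc l (u ++ r) y) (cong (l ++_) (++-assoc u r y)))))

-1-+ₚ-1 : const -1ℚ +ₚ const 1ℚ ≈ []
-1-+ₚ-1 = 0∷-zero ≈-refl

1-+ₚ-1 : const 1ℚ +ₚ const -1ℚ ≈ []
1-+ₚ-1 = 0∷-zero ≈-refl

1-≐ : 1q ≐ const 1ℚ /q^ 0
1-≐ = poly-≐ (const 1ℚ)

-1-≐ : -q 1q ≐ const -1ℚ /q^ 0
-1-≐ = ≐-resp-≈ (*ₚ-identityʳ (const -1ℚ)) (≐--q 1-≐)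

q-≐ : q ≐ q^ 1 /q^ 0
q-≐ = poly-≐ (q^ 1)

-q-≐ : -q q ≐ const -1ℚ *ₚ q^ 1 /q^ 0
-q-≐ = ≐--q q-≐

-q⁻¹-≐ : -q q⁻¹ ≐ const -1ℚ /q^ 1
-q⁻¹-≐ = ≐-resp-≈ (*ₚ-identityʳ (const -1ℚ)) (≐--q q⁻¹-≐)

module AssafToLam (N k : ℕ) where
  open Coefficientwise N

  LamTerm : Set
  LamTerm = Q.Term (LamGen k {N})

  AssafTerm : Set
  AssafTerm = Z.Term (AssafGen k {N})

  translateGen : ∀ {g} → AssafGen k {N} g → List LamTerm
  translateGen (mono w (ts , _))         = ts
  translateGen (far₁ a b c _ _ a+k<c)    = Q.term 1q (b ∷ []) _ [] (comm a c a+k<c) ∷ []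
  translateGen (far₂ a b c _ _ a+k<c)    = Q.term 1q [] _ (b ∷ []) (comm a c a+k<c) ∷ []
  translateGen (near₁ a b c a<b b<c c≤a+k) =
    Q.term (-q q) [] _ (c ∷ []) (qcomm a b a<b (ℕP.<-≤-trans b<c c≤a+k)) ∷
    Q.term q (a ∷ []) _ [] (qcomm b c b<c (ℕP.≤-<-trans c≤a+k (ℕP.+-monoˡ-< k a<b))) ∷ []
  translateGen (near₂ a b c a<b b<c c≤a+k) =
    Q.term 1q [] _ (a ∷ []) (qcomm b c b<c (ℕP.≤-<-trans c≤a+k (ℕP.+-monoˡ-< k a<b))) ∷
    Q.term (-q 1q) (c ∷ []) _ [] (qcomm a b a<b (ℕP.<-≤-trans b<c c≤a+k)) ∷ []

  mono-≐ᶜ : ∀ w {G} → monoQ w Q.≋ G → G ≐ᶜ imageₚ (monoZ w) /q^ 0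
  mono-≐ᶜ w {G} w≋G = ≐ᶜ-intro at
    where
    at : ∀ v → Q.coeff G v ≐ P.coeff (imageₚ (monoZ w)) v /q^ 0
    at v with ≡-dec _≟ᶠ_ w v | w≋G v
    ... | yes _ | e = ≐-resp-≈ (+ₚ-congʳ [] (*ₚ-identityˡ (const 1ℚ))) (≈q-poly⇒≐ e)
    ... | no  _ | e = ≈q-poly⇒≐ e

  commutator-≐ᶜ : ∀ l r u v →
    Q.sandwich 1q l ((1q , u) ∷ (-q 1q , v) ∷ []) r ++ [] ≐ᶜ (const 1ℚ , l ++ u ++ r) ∷ (const -1ℚ , l ++ v ++ r) ∷ [] /q^ 0
  commutator-≐ᶜ l r u v = pointwise⇒≐ᶜ
    ( (refl , ≐-resp-≈ (*ₚ-identityˡ (const 1ℚ)) (≐-*q 1-≐ 1-≐))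
    ∷ (refl , ≐-resp-≈ (*ₚ-identityˡ (const -1ℚ)) (≐-*q 1-≐ -1-≐))
    ∷ [])

  translateGen-≐ᶜ : ∀ {g} (h : AssafGen k {N} g) → Q.evalTerms (translateGen h) ≐ᶜ imageₚ g /q^ 0
  translateGen-≐ᶜ (mono w (_ , w≋ts))  = mono-≐ᶜ w w≋ts
  translateGen-≐ᶜ (far₁ a b c _ _ _)   = commutator-≐ᶜ (b ∷ []) [] (a ∷ c ∷ []) (c ∷ a ∷ [])
  translateGen-≐ᶜ (far₂ a b c _ _ _)   = commutator-≐ᶜ [] (b ∷ []) (a ∷ c ∷ []) (c ∷ a ∷ [])
  -- the terms with q⁻¹ cancel only in the sum, so these are compared after multiplying by q
  translateGen-≐ᶜ (near₁ a b c _ _ _) = ≐ᶜ-unshift {1} (≐ᶜ-resp-≋ {L = L} (pointwise⇒≐ᶜ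
      ( (refl , ≐-shift {1} (≐-*q -q-≐ 1-≐)) ∷ (refl , ≐-*q -q-≐ -q⁻¹-≐)
      ∷ (refl , ≐-shift {1} (≐-*q q-≐ 1-≐))  ∷ (refl , ≐-*q q-≐ -q⁻¹-≐) ∷ []))
    (≋-trans (swap-≋ P₁ abc P₂ bac _)
      (∷-≋ bac e₂ (≋-trans (cancel-≋ P₁ P₃ abc _ z₁₃) (∷-≋ acb (*ₚ-comm q¹ M) ≋-refl)))))
    where
    M = const -1ℚ ; O = const 1ℚ ; q¹ = q^ 1
    abc = a ∷ b ∷ c ∷ [] ; bac = b ∷ a ∷ c ∷ [] ; acb = a ∷ c ∷ b ∷ []
    P₁ = ((M *ₚ q¹) *ₚ O) *ₚ q¹ ; P₂ = (M *ₚ q¹) *ₚ M ; P₃ = (q¹ *ₚ O) *ₚ q¹ ; P₄ = q¹ *ₚ M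
    L = (P₁ , abc) ∷ (P₂ , bac) ∷ (P₃ , abc) ∷ (P₄ , acb) ∷ []
    e₂ : P₂ ≈ O *ₚ q¹
    e₂ = ≈-trans (xy∙z≈xz∙y M q¹ M) (*ₚ-congʳ q¹ {M *ₚ M} {O} (const-*ₚ -1ℚ -1ℚ))
    reassoc : ∀ a b c → ((a *ₚ b) *ₚ c) *ₚ b ≈ a *ₚ ((b *ₚ c) *ₚ b)
    reassoc = ℚ[q]-solve 3 (λ a b c → ((a :* b) :* c) :* b := a :* ((b :* c) :* b)) ≈-refl
    z₁₃ : P₁ +ₚ P₃ ≈ []
    z₁₃ = begin
      P₁ +ₚ P₃                ≈⟨ +ₚ-cong (reassoc M q¹ O) (*ₚ-identityˡ P₃) ⟨
      (M *ₚ P₃) +ₚ (O *ₚ P₃)  ≈⟨ *ₚ-distribʳ P₃ M O ⟨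
      (M +ₚ O) *ₚ P₃          ≈⟨ *ₚ-congʳ P₃ {M +ₚ O} {[]} -1-+ₚ-1 ⟩
      []                      ∎
      where open ℚ[q]-Reasoning
  translateGen-≐ᶜ (near₂ a b c _ _ _) = ≐ᶜ-unshift {1} (≐ᶜ-resp-≋ {L = L} (pointwise⇒≐ᶜ
      ( (refl , ≐-shift {1} (≐-*q 1-≐ 1-≐))  ∷ (refl , ≐-*q 1-≐ -q⁻¹-≐)
      ∷ (refl , ≐-shift {1} (≐-*q -1-≐ 1-≐)) ∷ (refl , ≐-*q -1-≐ -q⁻¹-≐) ∷ []))
    (∷-≋ bca (*ₚ-congʳ q¹ {O *ₚ O} {O} (*ₚ-identityˡ O)) (≋-trans (swap-≋ P₂ cba P₃ cab _)
      (∷-≋ cab (*ₚ-congʳ q¹ {M *ₚ O} {M} (*ₚ-identityʳ M)) (cancel-≋ P₂ P₄ cba [] z₂₄)))))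
    where
    M = const -1ℚ ; O = const 1ℚ ; q¹ = q^ 1
    bca = b ∷ c ∷ a ∷ [] ; cba = c ∷ b ∷ a ∷ [] ; cab = c ∷ a ∷ b ∷ []
    P₁ = (O *ₚ O) *ₚ q¹ ; P₂ = O *ₚ M ; P₃ = (M *ₚ O) *ₚ q¹ ; P₄ = M *ₚ M
    L = (P₁ , bca) ∷ (P₂ , cba) ∷ (P₃ , cab) ∷ (P₄ , cba) ∷ []
    z₂₄ : P₂ +ₚ P₄ ≈ []
    z₂₄ = ≈-trans (≈-sym (*ₚ-distribʳ M O M)) (*ₚ-congʳ M {O +ₚ M} {[]} 1-+ₚ-1)

  translate : AssafTerm → List LamTerm
  translate (Z.term c x _ y h) = map (sandwichTerm (fromℤq c) x y) (translateGen h)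

  translate-≐ᶜ : ∀ c x g y (h : AssafGen k {N} g) →
    Q.evalTerms (translate (Z.term c x g y h)) ≐ᶜ imageₚ (Z.sandwich c x g y) /q^ 0
  translate-≐ᶜ c x g y h =
    ≐ᶜ-resp-≅ (≅-sym ∘ pointwise⇒coeff-≅ (evalTerms-sandwichTerm (const (toℚ c)) x y (translateGen h)))
      (≐ᶜ-resp-≋ (≐ᶜ-sandwich (const (toℚ c)) x y (translateGen-≐ᶜ h)) (imageₚ-sandwich c x g y))

  translateAll-≐ᶜ : ∀ ts → Q.evalTerms (concatMap translate ts) ≐ᶜ imageₚ (Z.evalTerms ts) /q^ 0
  translateAll-≐ᶜ []                       = ≐ᶜ-intro λ _ → 0q-≐
  translateAll-≐ᶜ (Z.term c x g y h ∷ ts) =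
    subst₂ (λ F L → F ≐ᶜ L /q^ 0)
      (sym (evalTerms-++ (translate (Z.term c x g y h)) (concatMap translate ts)))
      (sym (imageₚ-++ (Z.sandwich c x g y) (Z.evalTerms ts)))
      (≐ᶜ-++ (translate-≐ᶜ c x g y h) (translateAll-≐ᶜ ts))

proposition4p11 : (k : ℕ) → 1 ≤ k → (N : ℕ) → (f : 𝒰.Elt N) →
    InIAssaf k f → InJLam k (image f)
proposition4p11 k _ N f (ts , f≋ts) = concatMap translate ts , λ w →
  ≐-unique (≐ᶜ-at (image-≐ᶜ f) w) (≐ᶜ-at translation-≐ᶜ w)
  where
  open Coefficientwise N
  open AssafToLam N k
  translation-≐ᶜ : Q.evalTerms (concatMap translate ts) ≐ᶜ imageₚ f /q^ 0
  translation-≐ᶜ = ≐ᶜ-resp-≋ (translateAll-≐ᶜ ts) (imageₚ-cong {Z.evalTerms ts} {f} (sym ∘ f≋ts))
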